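{- Every $\omega$-model of $\mathrm{SRT}^2_2$ (i.e., every Turing ideal $\mathcal I$ such that every stable 2-coloring of $[\mathbb N]^2$ in $\mathcal I$ has an infinite homogeneous set in $\mathcal I$) is a model of $\mathrm{DNR}$: for every $X\in\mathcal I$ there is a function $h\in\mathcal I$ that is diagonally noncomputable relative to $X$.
   Context: A Turing ideal is a nonempty subset of $2^\omega$ closed under Turing reducibility and join. A 2-coloring $C$ of $[\mathbb N]^2$ is stable if for each $x$ there are $y$ and $c<2$ with $C(\{x,z\})=c$ for all $z>y$; $H$ is homogeneous for $C$ if $C$ is constant on $[H]^2$. A total function $h:\mathbb N\to\mathbb N$ is diagonally noncomputable relative to $X$ if $h(e)\neq\Phi^X_e(e)$ for all $e$ (where $\Phi^X_e$ is the $e$-th Turing functional with oracle $X$, and the inequality holds trivially when $\Phi^X_e(e)$ diverges). $\mathrm{DNR}$ is the principle: for every set $X$ there is a function diagonally noncomputable relative to $X$. -}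

module Defs where

open import Data.Bool using (Bool; true; false; if_then_else_; T)
open import Data.Nat using (ℕ; zero; suc; _+_; _⊔_; _≤_; s≤s; _<_; _≡ᵇ_; _<?_; _/_; _%_)
open import Data.Nat.Properties using (+-suc; +-identityʳ; +-comm; suc-injective; <-cmp; m≤m⊔n; m≤n⊔m; m⊔n≤o⇒m≤o; m⊔n≤o⇒n≤o)
open import Data.Product using (Σ; ∃; ∃₂; _×_; _,_; proj₁; proj₂; ∃-syntax)
open import Relation.Binary.Definitions using (tri<; tri≈; tri>)
open import Relation.Binary.PropositionalEquality using (_≡_; refl; sym; trans; cong; cong₂)
open import Relation.Nullary using (¬_; yes; no; contradiction)
open import Relation.Unary using (Pred)

2^ω : Set
2^ω = ℕ → Bool

infix 4 _∈ₛ_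
_∈ₛ_ : ℕ → 2^ω → Set
n ∈ₛ A = T (A n)

χ : Bool → ℕ
χ b = if b then 1 else 0

-- Cantor's pairing bijection.  `unpair` walks along the antidiagonals in
-- the order (0,0), (1,0), (0,1), (2,0), (1,1), (0,2), …

triangle : ℕ → ℕ
triangle zero    = 0
triangle (suc n) = suc n + triangle n

⟨_,_⟩ : ℕ → ℕ → ℕ
⟨ x , y ⟩ = triangle (x + y) + y

next : ℕ × ℕ → ℕ × ℕ
next (zero  , y) = suc y , 0
next (suc x , y) = x , suc y

unpair : ℕ → ℕ × ℕ
unpair zero    = 0 , 0
unpair (suc n) = next (unpair n)

π₁ π₂ : ℕ → ℕ
π₁ n = proj₁ (unpair n)
π₂ n = proj₂ (unpair n)

pair-next : ∀ p → ⟨ proj₁ (next p) , proj₂ (next p) ⟩ ≡ suc ⟨ proj₁ p , proj₂ p ⟩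
pair-next (zero  , y) rewrite +-identityʳ y | +-identityʳ (y + triangle y) = cong suc (+-comm y (triangle y))
pair-next (suc x , y) rewrite +-suc x y = +-suc (triangle (suc (x + y))) y

pair-unpair : ∀ n → ⟨ π₁ n , π₂ n ⟩ ≡ n
pair-unpair zero    = refl
pair-unpair (suc n) = trans (pair-next (unpair n)) (cong suc (pair-unpair n))

unpair-pair : ∀ x y → unpair ⟨ x , y ⟩ ≡ (x , y)
unpair-pair x y = go (x + y) x y refl
  where
  go : ∀ s x y → x + y ≡ s → unpair ⟨ x , y ⟩ ≡ (x , y)
  go zero    zero    zero    eq = refl
  go (suc s) (suc x) zero    eq =
    trans (cong unpair (pair-next (zero , x)))
          (cong next (go s zero x (trans (sym (+-identityʳ x)) (suc-injective eq))))
  go s       x       (suc y) eq =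
    trans (cong unpair (pair-next (suc x , y)))
          (cong next (go s (suc x) y (trans (sym (+-suc x y)) eq)))

-- Programs for the unary partial functions that are partial recursive
-- relative to an oracle (Kleene's schemata; several arguments are passed
-- as one number through the pairing bijection).

data Code : Set where
  zer succ left right oracle : Code
  pair comp prec             : Code → Code → Code
  mu                         : Code → Code

-- Partial functions are represented by their graphs.

_⇀_ : Set → Set → Set₁
A ⇀ B = A → B → Set

primRec : (ℕ ⇀ ℕ) → (ℕ ⇀ ℕ) → ℕ → (ℕ ⇀ ℕ)
primRec F G a zero    v = F a v
primRec F G a (suc k) v = ∃[ r ] primRec F G a k r × G ⟨ a , ⟨ k , r ⟩ ⟩ v

⟦_⟧ : Code → 2^ω → (ℕ ⇀ ℕ)
⟦ zer      ⟧ X n v = v ≡ 0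
⟦ succ     ⟧ X n v = v ≡ suc n
⟦ left     ⟧ X n v = v ≡ π₁ n
⟦ right    ⟧ X n v = v ≡ π₂ n
⟦ oracle   ⟧ X n v = v ≡ χ (X n)
⟦ pair f g ⟧ X n v = ∃₂ λ a b → ⟦ f ⟧ X n a × ⟦ g ⟧ X n b × v ≡ ⟨ a , b ⟩
⟦ comp f g ⟧ X n v = ∃[ m ] ⟦ g ⟧ X n m × ⟦ f ⟧ X m v
⟦ prec f g ⟧ X n v = primRec (⟦ f ⟧ X) (⟦ g ⟧ X) (π₁ n) (π₂ n) v
⟦ mu f     ⟧ X n v = ⟦ f ⟧ X ⟨ n , v ⟩ 0 × (∀ i → i < v → ∃[ k ] ⟦ f ⟧ X ⟨ n , i ⟩ (suc k))

⟦⟧-functional : ∀ p {X n v w} → ⟦ p ⟧ X n v → ⟦ p ⟧ X n w → v ≡ w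
⟦⟧-functional zer    a b = trans a (sym b)
⟦⟧-functional succ   a b = trans a (sym b)
⟦⟧-functional left   a b = trans a (sym b)
⟦⟧-functional right  a b = trans a (sym b)
⟦⟧-functional oracle a b = trans a (sym b)
⟦⟧-functional (pair f g) (_ , _ , a , b , refl) (_ , _ , c , d , refl) =
  cong₂ ⟨_,_⟩ (⟦⟧-functional f a c) (⟦⟧-functional g b d)
⟦⟧-functional (comp f g) (_ , a , b) (_ , c , d) with refl ← ⟦⟧-functional g a c =
  ⟦⟧-functional f b d
⟦⟧-functional (prec f g) {X} {n} = go (π₂ n)
  where
  go : ∀ k {v w} → primRec (⟦ f ⟧ X) (⟦ g ⟧ X) (π₁ n) k v → primRec (⟦ f ⟧ X) (⟦ g ⟧ X) (π₁ n) k w → v ≡ w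
  go zero    a b = ⟦⟧-functional f a b
  go (suc k) (_ , a , b) (_ , c , d) with refl ← go k a c = ⟦⟧-functional g b d
⟦⟧-functional (mu f) {v = v} {w} (a , a′) (b , b′) with <-cmp v w
... | tri≈ _ eq _ = eq
... | tri< v<w _ _ = contradiction (⟦⟧-functional f a (proj₂ (b′ v v<w))) λ ()
... | tri> _ _ w<v = contradiction (⟦⟧-functional f b (proj₂ (a′ w w<v))) λ ()

encode : Code → ℕ
encode zer        = ⟨ 0 , 0 ⟩
encode succ       = ⟨ 1 , 0 ⟩
encode left       = ⟨ 2 , 0 ⟩
encode right      = ⟨ 3 , 0 ⟩
encode oracle     = ⟨ 4 , 0 ⟩
encode (pair f g) = ⟨ 5 , ⟨ encode f , encode g ⟩ ⟩
encode (comp f g) = ⟨ 6 , ⟨ encode f , encode g ⟩ ⟩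
encode (prec f g) = ⟨ 7 , ⟨ encode f , encode g ⟩ ⟩
encode (mu f)     = ⟨ 8 , encode f ⟩

-- A left inverse of `encode`, with a bound on the recursion depth.

decode : ℕ → ℕ → Code
decode₂ : ℕ → (Code → Code → Code) → ℕ → Code
decodeTag : ℕ → ℕ × ℕ → Code
decode zero    _ = zer
decode (suc d) e = decodeTag d (unpair e)
decode₂ d con e = con (decode d (π₁ e)) (decode d (π₂ e))
decodeTag d (0 , _) = zer
decodeTag d (1 , _) = succ
decodeTag d (2 , _) = left
decodeTag d (3 , _) = right
decodeTag d (4 , _) = oracle
decodeTag d (5 , e) = decode₂ d pair e
decodeTag d (6 , e) = decode₂ d comp e
decodeTag d (7 , e) = decode₂ d prec e
decodeTag d (_ , e) = mu (decode d e)

depth : Code → ℕ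
depth (pair f g) = suc (depth f ⊔ depth g)
depth (comp f g) = suc (depth f ⊔ depth g)
depth (prec f g) = suc (depth f ⊔ depth g)
depth (mu f)     = suc (depth f)
depth _          = 1

decode-encode : ∀ p {d} → depth p ≤ d → decode d (encode p) ≡ p
decode₂-encode : ∀ con f g {d} → depth f ⊔ depth g ≤ d → decode₂ d con ⟨ encode f , encode g ⟩ ≡ con f g
decode-encode zer    (s≤s _) = refl
decode-encode succ   (s≤s _) = refl
decode-encode left   (s≤s _) = refl
decode-encode right  (s≤s _) = refl
decode-encode oracle (s≤s _) = refl
decode-encode (pair f g) (s≤s {n = d} le) =
  trans (cong (decodeTag d) (unpair-pair 5 ⟨ encode f , encode g ⟩)) (decode₂-encode pair f g le)
decode-encode (comp f g) (s≤s {n = d} le) =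
  trans (cong (decodeTag d) (unpair-pair 6 ⟨ encode f , encode g ⟩)) (decode₂-encode comp f g le)
decode-encode (prec f g) (s≤s {n = d} le) =
  trans (cong (decodeTag d) (unpair-pair 7 ⟨ encode f , encode g ⟩)) (decode₂-encode prec f g le)
decode-encode (mu f) (s≤s {n = d} le) =
  trans (cong (decodeTag d) (unpair-pair 8 (encode f))) (cong mu (decode-encode f le))
decode₂-encode con f g {d} le rewrite unpair-pair (encode f) (encode g) =
  cong₂ con (decode-encode f (m⊔n≤o⇒m≤o (depth f) (depth g) le))
            (decode-encode g (m⊔n≤o⇒n≤o (depth f) (depth g) le))

encode-injective : ∀ {p q} → encode p ≡ encode q → p ≡ q
encode-injective {p} {q} eq =
  trans (sym (decode-encode p (m≤m⊔n (depth p) (depth q))))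
        (trans (cong (decode (depth p ⊔ depth q)) eq) (decode-encode q (m≤n⊔m (depth p) (depth q))))

-- Φ X e n v says that the e-th Turing functional with oracle X converges
-- on n with value v; a number e that codes no program indexes the nowhere
-- defined functional.

Φ : 2^ω → ℕ → (ℕ ⇀ ℕ)
Φ X e n v = Σ Code λ p → encode p ≡ e × ⟦ p ⟧ X n v

Φ-functional : ∀ {X e n v w} → Φ X e n v → Φ X e n w → v ≡ w
Φ-functional (p , eq , a) (q , eq′ , b)
  with refl ← encode-injective {p} {q} (trans eq (sym eq′)) = ⟦⟧-functional p a b

infix 4 _≤T_
_≤T_ : 2^ω → 2^ω → Set
A ≤T B = ∃[ e ] ∀ n → Φ B e n (χ (A n))

infixr 6 _⊕_
_⊕_ : 2^ω → 2^ω → 2^ω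
(A ⊕ B) n = if n % 2 ≡ᵇ 0 then A (n / 2) else B (n / 2)

record IsTuringIdeal {ℓ} (I : Pred 2^ω ℓ) : Set ℓ where
  field
    nonempty  : ∃[ A ] I A
    ≤T-closed : ∀ {A B} → I B → A ≤T B → I A
    ⊕-closed  : ∀ {A B} → I A → I B → I (A ⊕ B)

-- Functions and colorings belong to an ideal when these sets coding them do.

graph : (ℕ → ℕ) → 2^ω
graph h n = h (π₁ n) ≡ᵇ π₂ n

-- An element {x, y} of [ℕ]² is given by its increasing enumeration x < y.

Coloring : Set
Coloring = (x y : ℕ) → .(x < y) → Bool

colorSet : Coloring → 2^ω
colorSet C n with π₁ n <? π₂ n
... | yes x<y = C (π₁ n) (π₂ n) x<y
... | no  _   = false

-- The condition x < z makes {x, z} a two-element set; replacing y by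
-- max(x, y) shows that it costs no generality.

Stable : Coloring → Set
Stable C = ∀ x → ∃₂ λ y c → ∀ z → y < z → (x<z : x < z) → C x z x<z ≡ c

Homogeneous : Coloring → 2^ω → Set
Homogeneous C H = ∃[ c ] ∀ x y → x ∈ₛ H → y ∈ₛ H → (x<y : x < y) → C x y x<y ≡ c

Infinite : 2^ω → Set
Infinite H = ∀ n → ∃[ m ] n < m × m ∈ₛ H

DiagonallyNoncomputable : 2^ω → (ℕ → ℕ) → Set
DiagonallyNoncomputable X h = ∀ e → ¬ Φ X e e (h e)

_⊨SRT²₂ : ∀ {ℓ} → Pred 2^ω ℓ → Set ℓ
I ⊨SRT²₂ = ∀ C → I (colorSet C) → Stable C → ∃[ H ] I H × Infinite H × Homogeneous C H

_⊨DNR : ∀ {ℓ} → Pred 2^ω ℓ → Set ℓ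
I ⊨DNR = ∀ X → I X → ∃[ h ] I (graph h) × DiagonallyNoncomputable X h

{-# OPTIONS --safe #-}
-- From the oracle X one computes a coloring C(x, z) = A_z(x), where A_z
-- approximates a set A that is effectively bi-immune relative to X: reading
-- the value of Φ_e(e), if any, as a tuple, requirement ⟨ e , i ⟩ puts one of its
-- entries, not claimed by an earlier requirement, on side i of A.  Only
-- requirements r < x may act on x, so C is stable.  If H is homogeneous, let
-- h(e) be a tuple of r + 1 distinct elements of H above r = ⟨ e , i ⟩, where i is
-- the side opposite to H.  If h(e) were Φ_e(e), the pigeonhole principle would
-- leave r an unclaimed entry to put on side i, contradicting homogeneity.
--
-- Constructively, the stability of C requires deciding whether Φ_e(e)
-- converges.  SRT²₂ itself decides this: for a monotone sequence a in the
-- ideal, the color of a homogeneous set for {x < z} ↦ a x tells whether a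
-- ever becomes true.
module Submission where

open import Level using (Level)
open import Relation.Unary using (Pred)
open import Defs

open import Data.Bool using (Bool; true; false; T)
open import Data.Fin using (Fin; toℕ; fromℕ<)
open import Data.Fin.Properties using (pigeonhole; toℕ<n; toℕ-fromℕ<)
open import Data.List using (List; []; _∷_)
open import Data.Nat using (ℕ; zero; suc; _+_; _∸_; _⊔_; _≤_; _<_; z≤n; s≤s; _≡ᵇ_; _<?_)
open import Data.Nat.Properties
open import Data.Product using (∃-syntax; _×_; _,_; proj₁; proj₂)
open import Data.Sum using (_⊎_; inj₁; inj₂; [_,_]′)
open import Data.Unit using (tt)
open import Relation.Binary.PropositionalEquality
open import Relation.Nullary using (¬_; yes; no; contradiction)

-- Primitive operations, their equations, and bounded search.

lookupOr : ℕ → List ℕ → ℕ → ℕ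
lookupOr i       []       d = d
lookupOr zero    (a ∷ as) d = a
lookupOr (suc i) (a ∷ as) d = lookupOr i as d

-- These operations are abstract so that the unifier can treat them as
-- rigid when it reads off a `Computable` derivation from a goal.
abstract
  ⟪_,_⟫ : ℕ → ℕ → ℕ
  ⟪ m , n ⟫ = ⟨ m , n ⟩

  fst snd : ℕ → ℕ
  fst = π₁
  snd = π₂

  rec : ℕ → (ℕ → ℕ → ℕ) → ℕ → ℕ
  rec b s zero    = b
  rec b s (suc k) = s k (rec b s k)

  ifZero : ℕ → ℕ → ℕ → ℕ
  ifZero zero    a b = a
  ifZero (suc _) a b = b

  eq : ℕ → ℕ → ℕ
  eq m n = χ (m ≡ᵇ n)

  select : ℕ → List ℕ → ℕ → ℕ
  select = lookupOr

  ⟪⟫≡⟨⟩ : ∀ m n → ⟪ m , n ⟫ ≡ ⟨ m , n ⟩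
  ⟪⟫≡⟨⟩ m n = refl

  fst≡π₁ : ∀ n → fst n ≡ π₁ n
  fst≡π₁ n = refl

  snd≡π₂ : ∀ n → snd n ≡ π₂ n
  snd≡π₂ n = refl

  fst-⟪⟫ : ∀ m n → fst ⟪ m , n ⟫ ≡ m
  fst-⟪⟫ m n = cong proj₁ (unpair-pair m n)

  snd-⟪⟫ : ∀ m n → snd ⟪ m , n ⟫ ≡ n
  snd-⟪⟫ m n = cong proj₂ (unpair-pair m n)

  rec-zero : ∀ b s → rec b s 0 ≡ b
  rec-zero b s = refl

  rec-suc : ∀ b s k → rec b s (suc k) ≡ s k (rec b s k)
  rec-suc b s k = refl

  ifZero-zero : ∀ a b → ifZero 0 a b ≡ a
  ifZero-zero a b = refl

  ifZero-suc : ∀ n a b → ifZero (suc n) a b ≡ b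
  ifZero-suc n a b = refl

  select≡lookupOr : ∀ i as d → select i as d ≡ lookupOr i as d
  select≡lookupOr i as d = refl

  eq≡χ : ∀ m n → eq m n ≡ χ (m ≡ᵇ n)
  eq≡χ m n = refl

  -- Reduces the equality test to truncated subtraction, from which `eqᶜ` gets its program.
  eq≡ifZero-∸ : ∀ m n → eq m n ≡ ifZero (m ∸ n) (ifZero (n ∸ m) 1 0) 0
  eq≡ifZero-∸ zero    zero    = refl
  eq≡ifZero-∸ zero    (suc n) = refl
  eq≡ifZero-∸ (suc m) zero    = refl
  eq≡ifZero-∸ (suc m) (suc n) = eq≡ifZero-∸ m n

  eq-refl : ∀ n → eq n n ≡ 1
  eq-refl zero    = refl
  eq-refl (suc n) = eq-refl n

  eq-≢ : ∀ m n → m ≢ n → eq m n ≡ 0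
  eq-≢ zero    zero    m≢n = contradiction refl m≢n
  eq-≢ zero    (suc n) m≢n = refl
  eq-≢ (suc m) zero    m≢n = refl
  eq-≢ (suc m) (suc n) m≢n = eq-≢ m n λ m≡n → m≢n (cong suc m≡n)

fst-⟨⟩ : ∀ m n → fst ⟨ m , n ⟩ ≡ m
fst-⟨⟩ m n = trans (cong fst (sym (⟪⟫≡⟨⟩ m n))) (fst-⟪⟫ m n)

snd-⟨⟩ : ∀ m n → snd ⟨ m , n ⟩ ≡ n
snd-⟨⟩ m n = trans (cong snd (sym (⟪⟫≡⟨⟩ m n))) (snd-⟪⟫ m n)

-- The given zero `v` bounds the search, so it terminates structurally. The result has the shape
-- that the semantics of `mu` asks for.
least : ∀ (t : ℕ → ℕ) v → t v ≡ 0 → ∃[ w ] t w ≡ 0 × (∀ i → i < w → ∃[ k ] t i ≡ suc k)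
least t v tv≡0 with t 0 in eq₀
... | zero = 0 , eq₀ , λ _ ()
least t zero    tv≡0 | suc k = contradiction (trans (sym eq₀) tv≡0) λ ()
least t (suc v) tv≡0 | suc k with least (λ i → t (suc i)) v tv≡0
... | w , tw≡0 , below = suc w , tw≡0 , λ { zero _ → k , eq₀ ; (suc i) (s≤s i<w) → below i i<w }

-- Total functions computable from an oracle, and their closure properties.

record Computable (X : 2^ω) (f : ℕ → ℕ) : Set where
  constructor _by_
  field
    code     : Code
    computes : ∀ n → ⟦ code ⟧ X n (f n)

module _ {X : 2^ω} where

  private
    C : (ℕ → ℕ) → Set
    C = Computable X

  resp-≗ : ∀ {f g} → (∀ n → f n ≡ g n) → C f → C g
  resp-≗ f≗g (p by c) = p by λ n → subst (⟦ p ⟧ X n) (f≗g n) (c n)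

  ≤T-computable : ∀ {A : 2^ω} → C (λ n → χ (A n)) → A ≤T X
  ≤T-computable (p by c) = encode p , λ n → p , refl , c n

  infixr 9 _∘ᶜ_
  _∘ᶜ_ : ∀ {f g} → C f → C g → C (λ n → f (g n))
  _∘ᶜ_ {f} {g} (p by c) (q by d) = comp p q by λ n → g n , d n , c (g n)

  sucᶜ : ∀ {f} → C f → C (λ n → suc (f n))
  sucᶜ c = (succ by λ n → refl) ∘ᶜ c

  constᶜ : ∀ m → C (λ _ → m)
  constᶜ zero    = zer by λ n → refl
  constᶜ (suc m) = sucᶜ (constᶜ m)

  oracleᶜ : ∀ {f} → C f → C (λ n → χ (X (f n)))
  oracleᶜ c = (oracle by λ n → refl) ∘ᶜ c

  fstᶜ : ∀ {f} → C f → C (λ n → fst (f n))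
  fstᶜ c = (left by fst≡π₁) ∘ᶜ c

  sndᶜ : ∀ {f} → C f → C (λ n → snd (f n))
  sndᶜ c = (right by snd≡π₂) ∘ᶜ c

  ⟪_,_⟫ᶜ : ∀ {f g} → C f → C g → C (λ n → ⟪ f n , g n ⟫)
  ⟪_,_⟫ᶜ {f} {g} (p by c) (q by d) =
    pair p q by λ n → f n , g n , c n , d n , ⟪⟫≡⟨⟩ (f n) (g n)

  idᶜ : C (λ n → n)
  idᶜ = pair left right by λ n → π₁ n , π₂ n , refl , refl , sym (pair-unpair n)

  -- `prec` recurses on the second component with the first as parameter, so the program runs on
  -- `⟪ n , m n ⟫`. The step receives parameter, index and previous value packed as
  -- `⟪ n , ⟪ k , r ⟫ ⟫`.
  recᶜ : ∀ {b m} {s : ℕ → ℕ → ℕ → ℕ} → C b → C (λ t → s (fst t) (fst (snd t)) (snd (snd t))) → C m → C (λ n → rec (b n) (s n) (m n))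
  recᶜ {b} {m} {s} (p by c) (q by d) m-c =
    resp-≗ (λ n → cong₂ (λ a k → rec (b a) (s a) k) (fst-⟪⟫ n (m n)) (snd-⟪⟫ n (m n)))
      ((prec p q by λ n → subst₂ (λ a k → primRec (⟦ p ⟧ X) (⟦ q ⟧ X) (π₁ n) (π₂ n) (rec (b a) (s a) k))
         (sym (fst≡π₁ n)) (sym (snd≡π₂ n)) (loop (π₁ n) (π₂ n)))
       ∘ᶜ ⟪ idᶜ , m-c ⟫ᶜ)
    where
    loop : ∀ a k → primRec (⟦ p ⟧ X) (⟦ q ⟧ X) a k (rec (b a) (s a) k)
    loop a zero    = subst (⟦ p ⟧ X a) (sym (rec-zero (b a) (s a))) (c a)
    loop a (suc k) = r , loop a k , subst₂ (⟦ q ⟧ X) args value (d ⟪ a , ⟪ k , r ⟫ ⟫)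
      where
      r = rec (b a) (s a) k
      args : ⟪ a , ⟪ k , r ⟫ ⟫ ≡ ⟨ a , ⟨ k , r ⟩ ⟩
      args = trans (⟪⟫≡⟨⟩ a ⟪ k , r ⟫) (cong (λ t → ⟨ a , t ⟩) (⟪⟫≡⟨⟩ k r))
      value : s (fst ⟪ a , ⟪ k , r ⟫ ⟫) (fst (snd ⟪ a , ⟪ k , r ⟫ ⟫)) (snd (snd ⟪ a , ⟪ k , r ⟫ ⟫)) ≡ rec (b a) (s a) (suc k)
      value rewrite fst-⟪⟫ a ⟪ k , r ⟫ | snd-⟪⟫ a ⟪ k , r ⟫ | fst-⟪⟫ k r | snd-⟪⟫ k r = sym (rec-suc (b a) (s a) k)

  -- Case distinction is a recursion whose step ignores the previous value.
  ifZeroᶜ : ∀ {t f g} → C t → C f → C g → C (λ n → ifZero (t n) (f n) (g n))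
  ifZeroᶜ {t} {f} {g} t-c f-c g-c = resp-≗ (λ n → case (t n)) (recᶜ f-c (g-c ∘ᶜ fstᶜ idᶜ) t-c)
    where
    case : ∀ {a b} m → rec a (λ _ _ → b) m ≡ ifZero m a b
    case {a} {b} zero    = trans (rec-zero a _) (sym (ifZero-zero a b))
    case {a} {b} (suc m) = trans (rec-suc a _ m) (sym (ifZero-suc m a b))

  -- Truncated subtraction iterates the predecessor, which is itself a recursion returning its
  -- index.
  ∸ᶜ : ∀ {f g} → C f → C g → C (λ n → f n ∸ g n)
  ∸ᶜ {f} {g} f-c g-c = resp-≗ (λ n → loop (f n) (g n))
    (recᶜ f-c (recᶜ (constᶜ 0) (fstᶜ (sndᶜ idᶜ)) (sndᶜ (sndᶜ idᶜ))) g-c)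
    where
    predecessor : ∀ n → rec 0 (λ k _ → k) n ≡ n ∸ 1
    predecessor zero    = rec-zero 0 _
    predecessor (suc n) = rec-suc 0 _ n
    loop : ∀ a k → rec a (λ _ r → rec 0 (λ k _ → k) r) k ≡ a ∸ k
    loop a zero    = rec-zero a _
    loop a (suc k) rewrite rec-suc a (λ _ r → rec 0 (λ k _ → k) r) k | loop a k =
      trans (predecessor (a ∸ k)) (trans (∸-+-assoc a k 1) (cong (a ∸_) (+-comm k 1)))

  eqᶜ : ∀ {f g} → C f → C g → C (λ n → eq (f n) (g n))
  eqᶜ {f} {g} f-c g-c = resp-≗ (λ n → sym (eq≡ifZero-∸ (f n) (g n)))
    (ifZeroᶜ (∸ᶜ f-c g-c) (ifZeroᶜ (∸ᶜ g-c f-c) (constᶜ 1) (constᶜ 0)) (constᶜ 0))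

  -- The length of the list is the same for all inputs, so a lookup is a fixed nest of case
  -- distinctions.
  data Computables : (ℕ → List ℕ) → Set where
    []  : Computables (λ _ → [])
    _∷_ : ∀ {f fs} → C f → Computables fs → Computables (λ n → f n ∷ fs n)

  selectᶜ : ∀ {t fs d} → C t → Computables fs → C d → C (λ n → select (t n) (fs n) (d n))
  selectᶜ {t} {d = d} t-c [] d-c = resp-≗ (λ n → sym (select≡lookupOr (t n) [] (d n))) d-c
  selectᶜ {t} {d = d} t-c (_∷_ {f} {fs} f-c fs-c) d-c =
    resp-≗ (λ n → case (t n) (fs n)) (ifZeroᶜ t-c f-c (selectᶜ (∸ᶜ t-c (constᶜ 1)) fs-c d-c))
    where
    case : ∀ {a d} i as → ifZero i a (select (i ∸ 1) as d) ≡ select i (a ∷ as) d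
    case {a} {d} zero    as = trans (ifZero-zero a _) (sym (select≡lookupOr 0 (a ∷ as) d))
    case {a} {d} (suc i) as = trans (ifZero-suc i a _)
      (trans (select≡lookupOr i as d) (sym (select≡lookupOr (suc i) (a ∷ as) d)))

  μᶜ : (t : ℕ → ℕ → ℕ) → C (λ p → t (fst p) (snd p)) → (∀ n → ∃[ v ] t n v ≡ 0) →
       ∃[ g ] C g × (∀ n → t n (g n) ≡ 0)
  μᶜ t (p by c) bound = g , (mu p by minimal) , λ n → proj₁ (proj₂ (first n))
    where
    first : ∀ n → ∃[ w ] t n w ≡ 0 × (∀ i → i < w → ∃[ k ] t n i ≡ suc k)
    first n = least (t n) (proj₁ (bound n)) (proj₂ (bound n))
    g : ℕ → ℕ
    g n = proj₁ (first n)
    at : ∀ n i → ⟦ p ⟧ X ⟨ n , i ⟩ (t n i)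
    at n i = subst₂ (⟦ p ⟧ X) (⟪⟫≡⟨⟩ n i) (cong₂ t (fst-⟪⟫ n i) (snd-⟪⟫ n i)) (c ⟪ n , i ⟫)
    minimal : ∀ n → ⟦ mu p ⟧ X n (g n)
    minimal n = subst (⟦ p ⟧ X ⟨ n , g n ⟩) (proj₁ (proj₂ (first n))) (at n (g n)) ,
      λ i i<w → let k , e = proj₂ (proj₂ (first n)) i i<w in k , subst (⟦ p ⟧ X ⟨ n , i ⟩) e (at n i)

  χ-≡ᵇᶜ : ∀ {f g} → C f → C g → C (λ n → χ (f n ≡ᵇ g n))
  χ-≡ᵇᶜ {f} {g} f-c g-c = resp-≗ (λ n → eq≡χ (f n) (g n)) (eqᶜ f-c g-c)

  graph-computable : ∀ {h} → C h → C (λ n → χ (graph h n))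
  graph-computable h-c = χ-≡ᵇᶜ (h-c ∘ᶜ (left by λ n → refl)) (right by λ n → refl)

  colorSet-computable : ∀ (c : ℕ → ℕ → Bool) → C (λ n → χ (c (fst n) (snd n))) →
                        C (λ n → χ (colorSet (λ x y _ → c x y) n))
  colorSet-computable c c-c = resp-≗ cases
    -- `colorSet` is `false` off the increasing pairs, and these are the pairs where `π₂ n ∸ π₁ n`
    -- is positive.
    (ifZeroᶜ (∸ᶜ (right by λ n → refl) (left by λ n → refl)) (constᶜ 0) c-c)
    where
    cases : ∀ n → ifZero (π₂ n ∸ π₁ n) 0 (χ (c (fst n) (snd n))) ≡ χ (colorSet (λ x y _ → c x y) n)
    cases n rewrite fst≡π₁ n | snd≡π₂ n with π₁ n <? π₂ n
    ... | no  x≮y rewrite m≤n⇒m∸n≡0 (≮⇒≥ x≮y) = ifZero-zero 0 _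
    ... | yes x<y with π₂ n ∸ π₁ n | m<n⇒0<n∸m x<y
    ...   | suc d | _ = ifZero-suc d 0 _

-- Simulation of programs by a step function.

-- A stack machine for the programs, with states coded by numbers: only the
-- completeness of its runs matters, since h may avoid more than Φ_e(e).
ev : ℕ → ℕ → ℕ → ℕ
ev e n k = ⟪ 0 , ⟪ e , ⟪ n , k ⟫ ⟫ ⟫

ret : ℕ → ℕ → ℕ
ret v k = ⟪ 1 , ⟪ v , k ⟫ ⟫

halt : ℕ → ℕ
halt v = ⟪ 2 , v ⟫

-- A frame stores what remains to be done with the value about to be returned, as tag, data and rest
-- of the stack. Tag `0` is kept for the empty stack, on which `retStep` halts.
pairFrame₁ : ℕ → ℕ → ℕ → ℕ
pairFrame₁ g n k = ⟪ 1 , ⟪ ⟪ g , n ⟫ , k ⟫ ⟫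

pairFrame₂ : ℕ → ℕ → ℕ
pairFrame₂ a k = ⟪ 2 , ⟪ a , k ⟫ ⟫

compFrame : ℕ → ℕ → ℕ
compFrame f k = ⟪ 3 , ⟪ f , k ⟫ ⟫

-- The awaited value is the one after `i` of `m` iterations.
precFrame : ℕ → ℕ → ℕ → ℕ → ℕ → ℕ
precFrame g a i m k = ⟪ 4 , ⟪ ⟪ g , ⟪ a , ⟪ i , m ⟫ ⟫ ⟫ , k ⟫ ⟫

muFrame : ℕ → ℕ → ℕ → ℕ → ℕ
muFrame f n i k = ⟪ 5 , ⟪ ⟪ f , ⟪ n , i ⟫ ⟫ , k ⟫ ⟫

precStep : ℕ → ℕ → ℕ → ℕ → ℕ → ℕ → ℕ
precStep g a i m v k = ifZero (eq i m) (ev g ⟪ a , ⟪ i , v ⟫ ⟫ (precFrame g a (suc i) m k)) (ret v k)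

muStep : ℕ → ℕ → ℕ → ℕ → ℕ → ℕ
muStep f n i v k = ifZero v (ret i k) (ev f ⟪ n , suc i ⟫ (muFrame f n (suc i) k))

retStep : ℕ → ℕ → ℕ → ℕ → ℕ
retStep v tag d k = select tag
  ( halt v
  ∷ ev (fst d) (snd d) (pairFrame₂ v k)
  ∷ ret ⟪ d , v ⟫ k
  ∷ ev d v k
  ∷ precStep (fst d) (fst (snd d)) (fst (snd (snd d))) (snd (snd (snd d))) v k
  ∷ [])
  (muStep (fst d) (fst (snd d)) (snd (snd d)) v k)

module Machine (X : 2^ω) where

  -- The list follows the tags of `encode`, and the default is `mu`. Numbers that code no program
  -- may also land there; nothing is claimed about their runs.
  evStep : ℕ → ℕ → ℕ → ℕ → ℕ
  evStep tag d n k = select tag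
    ( ret 0 k
    ∷ ret (suc n) k
    ∷ ret (fst n) k
    ∷ ret (snd n) k
    ∷ ret (χ (X n)) k
    ∷ ev (fst d) n (pairFrame₁ (snd d) n k)
    ∷ ev (snd d) n (compFrame (fst d) k)
    ∷ ev (fst d) (fst n) (precFrame (snd d) (fst n) 0 (snd n) k)
    ∷ [])
    (ev d ⟪ n , 0 ⟫ (muFrame d n 0 k))

  step : ℕ → ℕ
  step s = select (fst s)
    ( evStep (fst (fst (snd s))) (snd (fst (snd s))) (fst (snd (snd s))) (snd (snd (snd s)))
    ∷ retStep (fst (snd s)) (fst (snd (snd s))) (fst (snd (snd (snd s)))) (snd (snd (snd (snd s))))
    ∷ [])
    s

  evᶜ : ∀ {e n k} → Computable X e → Computable X n → Computable X k → Computable X (λ t → ev (e t) (n t) (k t))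
  evᶜ e n k = ⟪ constᶜ 0 , ⟪ e , ⟪ n , k ⟫ᶜ ⟫ᶜ ⟫ᶜ

  retᶜ : ∀ {v k} → Computable X v → Computable X k → Computable X (λ t → ret (v t) (k t))
  retᶜ v k = ⟪ constᶜ 1 , ⟪ v , k ⟫ᶜ ⟫ᶜ

  frameᶜ : ∀ tag {d k} → Computable X d → Computable X k → Computable X (λ t → ⟪ tag , ⟪ d t , k t ⟫ ⟫)
  frameᶜ tag d k = ⟪ constᶜ tag , ⟪ d , k ⟫ᶜ ⟫ᶜ

  retStepᶜ : ∀ {v tag d k} → Computable X v → Computable X tag → Computable X d → Computable X k →
             Computable X (λ t → retStep (v t) (tag t) (d t) (k t))
  retStepᶜ v tag d k = selectᶜ tag
    ( ⟪ constᶜ 2 , v ⟫ᶜ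
    ∷ evᶜ d₀ d₁ (frameᶜ 2 v k)
    ∷ retᶜ ⟪ d , v ⟫ᶜ k
    ∷ evᶜ d v k
    ∷ ifZeroᶜ (eqᶜ d₁₁₀ d₁₁₁)
        (evᶜ d₀ ⟪ d₁₀ , ⟪ d₁₁₀ , v ⟫ᶜ ⟫ᶜ (frameᶜ 4 ⟪ d₀ , ⟪ d₁₀ , ⟪ sucᶜ d₁₁₀ , d₁₁₁ ⟫ᶜ ⟫ᶜ ⟫ᶜ k))
        (retᶜ v k)
    ∷ [])
    (ifZeroᶜ v (retᶜ d₁₁ k) (evᶜ d₀ ⟪ d₁₀ , sucᶜ d₁₁ ⟫ᶜ (frameᶜ 5 ⟪ d₀ , ⟪ d₁₀ , sucᶜ d₁₁ ⟫ᶜ ⟫ᶜ k)))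
    where
    d₀   = fstᶜ d
    d₁   = sndᶜ d
    d₁₀  = fstᶜ d₁
    d₁₁  = sndᶜ d₁
    d₁₁₀ = fstᶜ d₁₁
    d₁₁₁ = sndᶜ d₁₁

  evStepᶜ : ∀ {tag d n k} → Computable X tag → Computable X d → Computable X n → Computable X k →
            Computable X (λ t → evStep (tag t) (d t) (n t) (k t))
  evStepᶜ tag d n k = selectᶜ tag
    ( retᶜ (constᶜ 0) k
    ∷ retᶜ (sucᶜ n) k
    ∷ retᶜ (fstᶜ n) k
    ∷ retᶜ (sndᶜ n) k
    ∷ retᶜ (oracleᶜ n) k
    ∷ evᶜ (fstᶜ d) n (frameᶜ 1 ⟪ sndᶜ d , n ⟫ᶜ k)
    ∷ evᶜ (sndᶜ d) n (frameᶜ 3 (fstᶜ d) k)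
    ∷ evᶜ (fstᶜ d) (fstᶜ n) (frameᶜ 4 ⟪ sndᶜ d , ⟪ fstᶜ n , ⟪ constᶜ 0 , sndᶜ n ⟫ᶜ ⟫ᶜ ⟫ᶜ k)
    ∷ [])
    (evᶜ d ⟪ n , constᶜ 0 ⟫ᶜ (frameᶜ 5 ⟪ d , ⟪ n , constᶜ 0 ⟫ᶜ ⟫ᶜ k))

  stepᶜ : Computable X step
  stepᶜ = selectᶜ (fstᶜ idᶜ)
    ( evStepᶜ (fstᶜ (fstᶜ s₁)) (sndᶜ (fstᶜ s₁)) (fstᶜ (sndᶜ s₁)) (sndᶜ (sndᶜ s₁))
    ∷ retStepᶜ (fstᶜ s₁) (fstᶜ (sndᶜ s₁)) (fstᶜ (sndᶜ (sndᶜ s₁))) (sndᶜ (sndᶜ (sndᶜ s₁)))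
    ∷ [])
    idᶜ
    where
    s₁ = sndᶜ idᶜ

  step-ev : ∀ tag d n k → step (ev ⟪ tag , d ⟫ n k) ≡ evStep tag d n k
  step-ev tag d n k
    rewrite fst-⟪⟫ 0 ⟪ ⟪ tag , d ⟫ , ⟪ n , k ⟫ ⟫ | snd-⟪⟫ 0 ⟪ ⟪ tag , d ⟫ , ⟪ n , k ⟫ ⟫
          | fst-⟪⟫ ⟪ tag , d ⟫ ⟪ n , k ⟫ | snd-⟪⟫ ⟪ tag , d ⟫ ⟪ n , k ⟫
          | fst-⟪⟫ tag d | snd-⟪⟫ tag d | fst-⟪⟫ n k | snd-⟪⟫ n k = select≡lookupOr 0 _ _

  step-ret : ∀ v tag d k → step (ret v ⟪ tag , ⟪ d , k ⟫ ⟫) ≡ retStep v tag d k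
  step-ret v tag d k
    rewrite fst-⟪⟫ 1 ⟪ v , ⟪ tag , ⟪ d , k ⟫ ⟫ ⟫ | snd-⟪⟫ 1 ⟪ v , ⟪ tag , ⟪ d , k ⟫ ⟫ ⟫
          | fst-⟪⟫ v ⟪ tag , ⟪ d , k ⟫ ⟫ | snd-⟪⟫ v ⟪ tag , ⟪ d , k ⟫ ⟫
          | fst-⟪⟫ tag ⟪ d , k ⟫ | snd-⟪⟫ tag ⟪ d , k ⟫ | fst-⟪⟫ d k | snd-⟪⟫ d k = select≡lookupOr 1 _ _

  step-halt : ∀ v → step (halt v) ≡ halt v
  step-halt v rewrite fst-⟪⟫ 2 v = select≡lookupOr 2 _ _

  run : ℕ → ℕ → ℕ
  run j s = rec s (λ _ → step) j

  runᶜ : ∀ {j s} → Computable X j → Computable X s → Computable X (λ t → run (j t) (s t))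
  runᶜ j s = recᶜ s (stepᶜ ∘ᶜ sndᶜ (sndᶜ idᶜ)) j

  run-+ : ∀ i j s → run (i + j) s ≡ run i (run j s)
  run-+ zero    j s = sym (rec-zero _ _)
  run-+ (suc i) j s = trans (rec-suc _ _ (i + j)) (trans (cong step (run-+ i j s)) (sym (rec-suc _ _ i)))

  infix 4 _⟶*_
  _⟶*_ : ℕ → ℕ → Set
  s ⟶* t = ∃[ j ] run j s ≡ t

  infixr 5 _◅◅_
  _◅◅_ : ∀ {s t u} → s ⟶* t → t ⟶* u → s ⟶* u
  _◅◅_ {s} (i , refl) (j , refl) = j + i , run-+ j i s

  done : ∀ {s} → s ⟶* s
  done = 0 , rec-zero _ _

  one : ∀ {s t} → step s ≡ t → s ⟶* t
  one eq₁ = 1 , trans (rec-suc _ _ 0) (trans (cong step (rec-zero _ _)) eq₁)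

  ev⟶ : ∀ tag d n k {t} → evStep tag d n k ≡ t → ev ⟨ tag , d ⟩ n k ⟶* t
  ev⟶ tag d n k eq₁ =
    one (trans (cong (λ e → step (ev e n k)) (sym (⟪⟫≡⟨⟩ tag d))) (trans (step-ev tag d n k) eq₁))

  ret⟶ : ∀ v tag d k {t} → retStep v tag d k ≡ t → ret v ⟪ tag , ⟪ d , k ⟫ ⟫ ⟶* t
  ret⟶ v tag d k eq₁ = one (trans (step-ret v tag d k) eq₁)

  ret-pairFrame₁ : ∀ a g n k → ret a (pairFrame₁ g n k) ⟶* ev g n (pairFrame₂ a k)
  ret-pairFrame₁ a g n k = ret⟶ a 1 ⟪ g , n ⟫ k
    (trans (select≡lookupOr 1 _ _) (cong₂ (λ g n → ev g n (pairFrame₂ a k)) (fst-⟪⟫ g n) (snd-⟪⟫ g n)))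

  ret-precFrame : ∀ g a i m v k → ret v (precFrame g a i m k) ⟶* precStep g a i m v k
  ret-precFrame g a i m v k = ret⟶ v 4 ⟪ g , ⟪ a , ⟪ i , m ⟫ ⟫ ⟫ k (trans (select≡lookupOr 4 _ _) projections)
    where
    d = ⟪ g , ⟪ a , ⟪ i , m ⟫ ⟫ ⟫
    projections : precStep (fst d) (fst (snd d)) (fst (snd (snd d))) (snd (snd (snd d))) v k ≡ precStep g a i m v k
    projections rewrite fst-⟪⟫ g ⟪ a , ⟪ i , m ⟫ ⟫ | snd-⟪⟫ g ⟪ a , ⟪ i , m ⟫ ⟫
      | fst-⟪⟫ a ⟪ i , m ⟫ | snd-⟪⟫ a ⟪ i , m ⟫ | fst-⟪⟫ i m | snd-⟪⟫ i m = refl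

  ret-precFrame-< : ∀ g a i m v k → i < m →
    ret v (precFrame g a i m k) ⟶* ev g ⟨ a , ⟨ i , v ⟩ ⟩ (precFrame g a (suc i) m k)
  ret-precFrame-< g a i m v k i<m = subst (ret v (precFrame g a i m k) ⟶*_) continue (ret-precFrame g a i m v k)
    where
    continue : precStep g a i m v k ≡ ev g ⟨ a , ⟨ i , v ⟩ ⟩ (precFrame g a (suc i) m k)
    continue rewrite eq-≢ i m (<⇒≢ i<m) | sym (⟪⟫≡⟨⟩ i v) | sym (⟪⟫≡⟨⟩ a ⟪ i , v ⟫) = ifZero-zero _ _

  ret-precFrame-≡ : ∀ g a m v k → ret v (precFrame g a m m k) ⟶* ret v k
  ret-precFrame-≡ g a m v k = subst (ret v (precFrame g a m m k) ⟶*_) stop (ret-precFrame g a m m v k)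
    where
    stop : precStep g a m m v k ≡ ret v k
    stop rewrite eq-refl m = ifZero-suc 0 _ _

  ret-muFrame : ∀ f n i v k → ret v (muFrame f n i k) ⟶* muStep f n i v k
  ret-muFrame f n i v k = ret⟶ v 5 ⟪ f , ⟪ n , i ⟫ ⟫ k (trans (select≡lookupOr 5 _ _) projections)
    where
    d = ⟪ f , ⟪ n , i ⟫ ⟫
    projections : muStep (fst d) (fst (snd d)) (snd (snd d)) v k ≡ muStep f n i v k
    projections rewrite fst-⟪⟫ f ⟪ n , i ⟫ | snd-⟪⟫ f ⟪ n , i ⟫ | fst-⟪⟫ n i | snd-⟪⟫ n i = refl

  ret-muFrame-suc : ∀ f n i v k → ret (suc v) (muFrame f n i k) ⟶* ev f ⟨ n , suc i ⟩ (muFrame f n (suc i) k)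
  ret-muFrame-suc f n i v k = subst (ret (suc v) (muFrame f n i k) ⟶*_)
    (trans (ifZero-suc v _ _) (cong (λ t → ev f t (muFrame f n (suc i) k)) (⟪⟫≡⟨⟩ n (suc i))))
    (ret-muFrame f n i (suc v) k)

  -- Induction on the program. The stack `k` is arbitrary so that the hypothesis applies to
  -- subprograms, which run with a frame pushed on top.
  complete : ∀ p {n v} → ⟦ p ⟧ X n v → ∀ k → ev (encode p) n k ⟶* ret v k
  complete zer    {n} refl k = ev⟶ 0 0 n k (select≡lookupOr 0 _ _)
  complete succ   {n} refl k = ev⟶ 1 0 n k (select≡lookupOr 1 _ _)
  complete left   {n} refl k = ev⟶ 2 0 n k (trans (select≡lookupOr 2 _ _) (cong (λ v → ret v k) (fst≡π₁ n)))
  complete right  {n} refl k = ev⟶ 3 0 n k (trans (select≡lookupOr 3 _ _) (cong (λ v → ret v k) (snd≡π₂ n)))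
  complete oracle {n} refl k = ev⟶ 4 0 n k (select≡lookupOr 4 _ _)
  complete (pair f g) {n} (a , b , fa , gb , refl) k =
       ev⟶ 5 ⟨ encode f , encode g ⟩ n k
         (trans (select≡lookupOr 5 _ _) (cong₂ (λ f g → ev f n (pairFrame₁ g n k)) (fst-⟨⟩ (encode f) (encode g)) (snd-⟨⟩ (encode f) (encode g))))
    ◅◅ complete f fa _
    ◅◅ ret-pairFrame₁ a (encode g) n k
    ◅◅ complete g gb _
    ◅◅ ret⟶ b 2 a k (trans (select≡lookupOr 2 _ _) (cong (λ v → ret v k) (⟪⟫≡⟨⟩ a b)))
  complete (comp f g) {n} (m , gm , fv) k =
       ev⟶ 6 ⟨ encode f , encode g ⟩ n k
         (trans (select≡lookupOr 6 _ _) (cong₂ (λ f g → ev g n (compFrame f k)) (fst-⟨⟩ (encode f) (encode g)) (snd-⟨⟩ (encode f) (encode g))))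
    ◅◅ complete g gm _
    ◅◅ ret⟶ m 3 (encode f) k (select≡lookupOr 3 _ _)
    ◅◅ complete f fv k
  complete (prec f g) {n} {v} rv k =
       ev⟶ 7 ⟨ encode f , encode g ⟩ n k (trans (select≡lookupOr 7 _ _) start)
    ◅◅ loop (π₂ n) ≤-refl rv
    ◅◅ ret-precFrame-≡ (encode g) (π₁ n) (π₂ n) v k
    where
    frame : ℕ → ℕ
    frame i = precFrame (encode g) (π₁ n) i (π₂ n) k
    start : ev (fst ⟨ encode f , encode g ⟩) (fst n) (precFrame (snd ⟨ encode f , encode g ⟩) (fst n) 0 (snd n) k)
            ≡ ev (encode f) (π₁ n) (frame 0)
    start rewrite fst-⟨⟩ (encode f) (encode g) | snd-⟨⟩ (encode f) (encode g) | fst≡π₁ n | snd≡π₂ n = refl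
    -- Invariant: the value after `j` iterations is returned to the frame that counts `j`.
    loop : ∀ j {r} → j ≤ π₂ n → primRec (⟦ f ⟧ X) (⟦ g ⟧ X) (π₁ n) j r →
           ev (encode f) (π₁ n) (frame 0) ⟶* ret r (frame j)
    loop zero    _   fr             = complete f fr (frame 0)
    loop (suc j) j<m (r , below , gr) =
         loop j (<⇒≤ j<m) below
      ◅◅ ret-precFrame-< (encode g) (π₁ n) j (π₂ n) r k j<m
      ◅◅ complete g gr (frame (suc j))
  complete (mu f) {n} {v} (fv , below) k =
       ev⟶ 8 (encode f) n k
         (trans (select≡lookupOr 8 _ _) (cong (λ t → ev (encode f) t (frame 0)) (⟪⟫≡⟨⟩ n 0)))
    ◅◅ loop v ≤-refl
    ◅◅ complete f fv (frame v)
    ◅◅ subst (ret 0 (frame v) ⟶*_) (ifZero-zero _ _) (ret-muFrame (encode f) n v 0 k)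
    where
    frame : ℕ → ℕ
    frame i = muFrame (encode f) n i k
    -- Below `v` every tested value is a successor, so each frame passes the search on to the next
    -- candidate.
    loop : ∀ j → j ≤ v → ev (encode f) ⟨ n , 0 ⟩ (frame 0) ⟶* ev (encode f) ⟨ n , j ⟩ (frame j)
    loop zero    _   = done
    loop (suc j) j<v =
         loop j (<⇒≤ j<v)
      ◅◅ complete f (proj₂ (below j j<v)) (frame j)
      ◅◅ ret-muFrame-suc (encode f) n j (proj₁ (below j j<v)) k

  -- Diagonal computations by stages.

  state : ℕ → ℕ → ℕ
  -- Program and input are both `e`; the initial stack is empty.
  state s e = run s (ev e e ⟪ 0 , ⟪ 0 , 0 ⟫ ⟫)

  stateᶜ : ∀ {s e} → Computable X s → Computable X e → Computable X (λ t → state (s t) (e t))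
  stateᶜ s e = runᶜ s (evᶜ e e (constᶜ _))

  halted : ℕ → ℕ → ℕ
  halted s e = select (fst (state s e)) (0 ∷ 0 ∷ []) 1

  -- While the machine runs, with state tag `0` or `1`, the value defaults to `0`; afterwards it is
  -- the output.
  value : ℕ → ℕ → ℕ
  value s e = select (fst (state s e)) (0 ∷ 0 ∷ []) (snd (state s e))

  haltedᶜ : ∀ {s e} → Computable X s → Computable X e → Computable X (λ t → halted (s t) (e t))
  haltedᶜ s e = selectᶜ (fstᶜ (stateᶜ s e)) (constᶜ 0 ∷ constᶜ 0 ∷ []) (constᶜ 1)

  valueᶜ : ∀ {s e} → Computable X s → Computable X e → Computable X (λ t → value (s t) (e t))
  valueᶜ s e = selectᶜ (fstᶜ (stateᶜ s e)) (constᶜ 0 ∷ constᶜ 0 ∷ []) (sndᶜ (stateᶜ s e))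

  fixed-run : ∀ j {s} → step s ≡ s → run j s ≡ s
  fixed-run zero    fixed = rec-zero _ _
  fixed-run (suc j) fixed = trans (rec-suc _ _ j) (trans (cong step (fixed-run j fixed)) fixed)

  fixed-state : ∀ {s z} e → s ≤ z → step (state s e) ≡ state s e → state z e ≡ state s e
  fixed-state {s} {z} e s≤z fixed =
    trans (cong (λ j → state j e) (sym (m∸n+n≡m s≤z))) (trans (run-+ (z ∸ s) s _) (fixed-run (z ∸ s) fixed))

  -- `halted` is `1` only for state tags from `2` on, where `step` takes its default and leaves the
  -- state unchanged.
  halted-state : ∀ {s z} e → s ≤ z → halted s e ≡ 1 → state z e ≡ state s e
  halted-state {s} e s≤z h≡1 =
    fixed-state e s≤z (trans (select≡lookupOr _ _ _) (default (fst (state s e)) (trans (sym (select≡lookupOr _ _ _)) h≡1)))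
    where
    default : ∀ i {a b d} → lookupOr i (0 ∷ 0 ∷ []) 1 ≡ 1 → lookupOr i (a ∷ b ∷ []) d ≡ d
    default (suc (suc i)) _ = refl

  halted-mono : ∀ {s z} e → s ≤ z → halted s e ≡ 1 → halted z e ≡ 1
  halted-mono e s≤z h≡1 = trans (cong (λ t → select (fst t) (0 ∷ 0 ∷ []) 1) (halted-state e s≤z h≡1)) h≡1

  halted-value : ∀ {s z} e → s ≤ z → halted s e ≡ 1 → value z e ≡ value s e
  halted-value e s≤z h≡1 = cong (λ t → select (fst t) (0 ∷ 0 ∷ []) (snd t)) (halted-state e s≤z h≡1)

  unhalted-value : ∀ s e → halted s e ≢ 1 → value s e ≡ 0
  unhalted-value s e h≢1 =
    trans (select≡lookupOr _ _ _) (junk (fst (state s e)) λ h≡1 → h≢1 (trans (select≡lookupOr _ _ _) h≡1))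
    where
    junk : ∀ i {d} → lookupOr i (0 ∷ 0 ∷ []) 1 ≢ 1 → lookupOr i (0 ∷ 0 ∷ []) d ≡ 0
    junk 0             _   = refl
    junk 1             _   = refl
    junk (suc (suc i)) ≢1 = contradiction refl ≢1

  -- By completeness the run returns `v` to the empty stack; one more step reaches `halt v`, a fixed
  -- point of `step`.
  Φ-value : ∀ e {v} → Φ X e e v → ∃[ s ] ∀ z → s ≤ z → value z e ≡ v
  Φ-value e {v} (p , refl , pv) with complete p pv ⟪ 0 , ⟪ 0 , 0 ⟫ ⟫ ◅◅ ret⟶ v 0 0 0 (select≡lookupOr 0 _ _)
  ... | s , reached = s , λ z s≤z →
    trans (cong (λ t → select (fst t) (0 ∷ 0 ∷ []) (snd t)) (trans (fixed-state e s≤z fixed) reached)) output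
    where
    fixed : step (state s e) ≡ state s e
    fixed rewrite reached = step-halt v
    output : select (fst (halt v)) (0 ∷ 0 ∷ []) (snd (halt v)) ≡ v
    output rewrite fst-⟪⟫ 2 v | snd-⟪⟫ 2 v = select≡lookupOr 2 _ _

-- Coded tuples and the choice of a fresh entry.

-- Tuples are coded as ⟪ x₀ , ⟪ x₁ , … ⟫ ⟫.
at : ℕ → ℕ → ℕ
at u i = fst (rec u (λ _ → snd) i)

at-zero : ∀ a u → at ⟪ a , u ⟫ 0 ≡ a
at-zero a u = trans (cong fst (rec-zero _ _)) (fst-⟪⟫ a u)

at-suc : ∀ a u i → at ⟪ a , u ⟫ (suc i) ≡ at u i
at-suc a u i = cong fst (shift i)
  where
  shift : ∀ i → rec ⟪ a , u ⟫ (λ _ → snd) (suc i) ≡ rec u (λ _ → snd) i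
  shift zero    = trans (rec-suc _ _ 0) (trans (cong snd (rec-zero _ _)) (trans (snd-⟪⟫ a u) (sym (rec-zero _ _))))
  shift (suc i) = trans (rec-suc _ _ (suc i)) (trans (cong snd (shift i)) (sym (rec-suc _ _ i)))

mem : ℕ → ℕ → ℕ → ℕ
mem y u n = rec 0 (λ i b → ifZero (eq (at u i) y) b 1) n

mem-cases : ∀ y u n → (mem y u n ≡ 0 × (∀ i → i < n → at u i ≢ y)) ⊎ (mem y u n ≡ 1 × ∃[ i ] i < n × at u i ≡ y)
mem-cases y u zero = inj₁ (rec-zero _ _ , λ _ ())
mem-cases y u (suc n) rewrite rec-suc 0 (λ i b → ifZero (eq (at u i) y) b 1) n with at u n ≟ y
... | yes refl rewrite eq-refl (at u n) = inj₂ (ifZero-suc 0 _ _ , n , ≤-refl , refl)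
... | no  ≢y rewrite eq-≢ (at u n) y ≢y | ifZero-zero (mem y u n) 1 with mem-cases y u n
...   | inj₁ (≡0 , absent) = inj₁ (≡0 , λ i i<1+n → [ absent i , (λ { refl → ≢y }) ]′ (m≤n⇒m<n∨m≡n (≤-pred i<1+n)))
...   | inj₂ (≡1 , i , i<n , ≡y) = inj₂ (≡1 , i , m<n⇒m<1+n i<n , ≡y)

-- Each later fresh entry overwrites the earlier choice, so the last one wins; the default is `0`.
pick : ℕ → ℕ → ℕ → ℕ → ℕ
pick u m v n = rec 0 (λ i x → ifZero (mem (at v i) u m) (at v i) x) n

pick-cases : ∀ u m v n →
  (∃[ i ] i < n × pick u m v n ≡ at v i × (∀ j → j < m → at u j ≢ at v i)) ⊎
  (∀ i → i < n → ∃[ j ] j < m × at u j ≡ at v i)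
pick-cases u m v zero = inj₂ λ _ ()
pick-cases u m v (suc n) rewrite rec-suc 0 (λ i x → ifZero (mem (at v i) u m) (at v i) x) n with mem-cases (at v n) u m
... | inj₁ (≡0 , absent) rewrite ≡0 = inj₁ (n , ≤-refl , ifZero-zero _ _ , absent)
... | inj₂ (≡1 , present) rewrite ≡1 | ifZero-suc 0 (at v n) (pick u m v n) with pick-cases u m v n
...   | inj₁ (i , i<n , ≡i , absent) = inj₁ (i , m<n⇒m<1+n i<n , ≡i , absent)
...   | inj₂ all = inj₂ λ i i<1+n → [ all i , (λ { refl → present }) ]′ (m≤n⇒m<n∨m≡n (≤-pred i<1+n))

Distinct : ℕ → ℕ → Set
Distinct v n = ∀ i j → i < j → j < n → at v i ≢ at v j

-- If no entry were fresh, matching entries would map `m + 1` positions of `v` into `m` positions of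
-- `u`, and a collision would contradict distinctness.
pick-fresh : ∀ u m v → Distinct v (suc m) →
  ∃[ i ] i ≤ m × pick u m v (suc m) ≡ at v i × (∀ j → j < m → at u j ≢ at v i)
pick-fresh u m v distinct with pick-cases u m v (suc m)
... | inj₁ (i , s≤s i≤m , found) = i , i≤m , found
... | inj₂ all with pigeonhole ≤-refl index
  where
  index : Fin (suc m) → Fin m
  index i = fromℕ< (proj₁ (proj₂ (all (toℕ i) (toℕ<n i))))
... | i , j , i<j , same = contradiction collision (distinct (toℕ i) (toℕ j) i<j (toℕ<n j))
  where
  position : ∀ (i : Fin (suc m)) → ∃[ k ] k < m × at u k ≡ at v (toℕ i)
  position i = all (toℕ i) (toℕ<n i)
  positions : proj₁ (position i) ≡ proj₁ (position j)
  positions = trans (sym (toℕ-fromℕ< _)) (trans (cong toℕ same) (toℕ-fromℕ< _))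
  collision : at v (toℕ i) ≡ at v (toℕ j)
  collision = trans (sym (proj₂ (proj₂ (position i)))) (trans (cong (at u) positions) (proj₂ (proj₂ (position j))))

-- Given a tuple t r for each requirement r, requirement r claims an entry
-- of t r not claimed before; `used t r` lists the claims of all r′ < r.
used : (ℕ → ℕ) → ℕ → ℕ
used t r = rec 0 (λ k u → ⟪ pick u k (t k) (suc k) , u ⟫) r

claim : (ℕ → ℕ) → ℕ → ℕ
claim t r = pick (used t r) r (t r) (suc r)

-- The least r < n that claims x marks it with suc (snd r); unclaimed
-- numbers have mark 0.
mark : (ℕ → ℕ) → ℕ → ℕ → ℕ
mark t x n = rec 0 (λ k b → ifZero b (ifZero (eq (claim t k) x) 0 (suc (snd k))) b) n

used-claim : ∀ t r r′ → r′ < r → ∃[ j ] j < r × at (used t r) j ≡ claim t r′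
used-claim t (suc r) r′ (s≤s r′≤r) rewrite rec-suc 0 (λ k u → ⟪ pick u k (t k) (suc k) , u ⟫) r with m≤n⇒m<n∨m≡n r′≤r
... | inj₂ refl = 0 , s≤s z≤n , at-zero _ _
... | inj₁ r′<r with used-claim t r r′ r′<r
...   | j , j<r , ≡claim = suc j , s≤s j<r , trans (at-suc _ _ j) ≡claim

-- Only `r` claims precede requirement `r`, so `r + 1` distinct entries suffice for `pick-fresh`.
claim-fresh : ∀ t r → Distinct (t r) (suc r) →
  ∃[ i ] i ≤ r × claim t r ≡ at (t r) i × (∀ r′ → r′ < r → claim t r′ ≢ claim t r)
claim-fresh t r distinct with pick-fresh (used t r) r (t r) distinct
... | i , i≤r , ≡i , absent = i , i≤r , ≡i , λ r′ r′<r same →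
  let j , j<r , ≡claim = used-claim t r r′ r′<r in absent j j<r (trans ≡claim (trans same ≡i))

mark-suc : ∀ t x n → mark t x (suc n) ≡ ifZero (mark t x n) (ifZero (eq (claim t n) x) 0 (suc (snd n))) (mark t x n)
mark-suc t x n = rec-suc _ _ n

mark-unclaimed : ∀ t x n → (∀ r → r < n → claim t r ≢ x) → mark t x n ≡ 0
mark-unclaimed t x zero    _     = rec-zero _ _
mark-unclaimed t x (suc n) other
  rewrite mark-suc t x n | mark-unclaimed t x n (λ r r<n → other r (m<n⇒m<1+n r<n)) | eq-≢ (claim t n) x (other n ≤-refl) =
  trans (ifZero-zero _ _) (ifZero-zero _ _)

-- By freshness the number is still unmarked when requirement `r` is reached, and a nonzero mark is
-- never overwritten.
mark-claim : ∀ t r n → (∀ r′ → r′ < r → claim t r′ ≢ claim t r) → r < n → mark t (claim t r) n ≡ suc (snd r)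
mark-claim t r (suc n) fresh (s≤s r≤n) with m≤n⇒m<n∨m≡n r≤n
... | inj₁ r<n rewrite mark-suc t (claim t r) n | mark-claim t r n fresh r<n = ifZero-suc _ _ _
... | inj₂ refl rewrite mark-suc t (claim t r) r | mark-unclaimed t (claim t r) r fresh | eq-refl (claim t r) =
  trans (ifZero-zero _ _) (ifZero-suc 0 _ _)

used-cong : ∀ {t t′} n → (∀ r → r < n → t r ≡ t′ r) → used t n ≡ used t′ n
used-cong zero    _    = trans (rec-zero _ _) (sym (rec-zero _ _))
used-cong {t} {t′} (suc n) same =
  trans (rec-suc _ _ n)
  (trans (cong₂ (λ u v → ⟪ pick u n v (suc n) , u ⟫) (used-cong n λ r r<n → same r (m<n⇒m<1+n r<n)) (same n ≤-refl))
         (sym (rec-suc _ _ n)))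

-- The first `n` claims depend only on the first `n` tuples. Hence the color of `x` settles once the
-- requests below `x` do.
mark-cong : ∀ {t t′} x n → (∀ r → r < n → t r ≡ t′ r) → mark t x n ≡ mark t′ x n
mark-cong x zero    _    = trans (rec-zero _ _) (sym (rec-zero _ _))
mark-cong {t} {t′} x (suc n) same =
  trans (mark-suc t x n)
  (trans (cong₂ (λ b y → ifZero b (ifZero (eq y x) 0 (suc (snd n))) b) (mark-cong x n below)
                (cong₂ (λ u v → pick u n v (suc n)) (used-cong n below) (same n ≤-refl)))
         (sym (mark-suc t′ x n)))
  where
  below : ∀ r → r < n → t r ≡ t′ r
  below r r<n = same r (m<n⇒m<1+n r<n)

-- Computability of claims and marks.

module _ {X : 2^ω} where

  private
    C : (ℕ → ℕ) → Set
    C = Computable X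

  atᶜ : ∀ {u i} → C u → C i → C (λ n → at (u n) (i n))
  atᶜ u i = fstᶜ (recᶜ u (sndᶜ (sndᶜ (sndᶜ idᶜ))) i)

  memᶜ : ∀ {y u m} → C y → C u → C m → C (λ n → mem (y n) (u n) (m n))
  memᶜ y u m = recᶜ (constᶜ 0)
    (ifZeroᶜ (eqᶜ (atᶜ (u ∘ᶜ fstᶜ idᶜ) (fstᶜ (sndᶜ idᶜ))) (y ∘ᶜ fstᶜ idᶜ)) (sndᶜ (sndᶜ idᶜ)) (constᶜ 1)) m

  pickᶜ : ∀ {u m v l} → C u → C m → C v → C l → C (λ n → pick (u n) (m n) (v n) (l n))
  pickᶜ u m v l = recᶜ (constᶜ 0)
    (ifZeroᶜ (memᶜ entry (u ∘ᶜ fstᶜ idᶜ) (m ∘ᶜ fstᶜ idᶜ)) entry (sndᶜ (sndᶜ idᶜ))) l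
    where
    entry = atᶜ (v ∘ᶜ fstᶜ idᶜ) (fstᶜ (sndᶜ idᶜ))

  module _ (t : ℕ → ℕ → ℕ) (tᶜ : ∀ {f g} → C f → C g → C (λ n → t (f n) (g n))) where

    usedᶜ : ∀ {z r} → C z → C r → C (λ n → used (t (z n)) (r n))
    usedᶜ z r = recᶜ (constᶜ 0)
      ⟪ pickᶜ (sndᶜ (sndᶜ idᶜ)) k (tᶜ (z ∘ᶜ fstᶜ idᶜ) k) (sucᶜ k) , sndᶜ (sndᶜ idᶜ) ⟫ᶜ r
      where
      k = fstᶜ (sndᶜ idᶜ)

    claimᶜ : ∀ {z r} → C z → C r → C (λ n → claim (t (z n)) (r n))
    claimᶜ z r = pickᶜ (usedᶜ z r) r (tᶜ z r) (sucᶜ r)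

    markᶜ : ∀ {z x m} → C z → C x → C m → C (λ n → mark (t (z n)) (x n) (m n))
    markᶜ z x m = recᶜ (constᶜ 0)
      (ifZeroᶜ b (ifZeroᶜ (eqᶜ (claimᶜ (z ∘ᶜ fstᶜ idᶜ) k) (x ∘ᶜ fstᶜ idᶜ)) (constᶜ 0) (sucᶜ (sndᶜ k))) b) m
      where
      k = fstᶜ (sndᶜ idᶜ)
      b = sndᶜ (sndᶜ idᶜ)

-- Mark `1` is read as the color `true` and mark `2` as `false`, so the mark `suc (χ c)` produces
-- the color opposite to `c`.
[1+χ≡ᵇ1]≢ : ∀ c → (suc (χ c) ≡ᵇ 1) ≢ c
[1+χ≡ᵇ1]≢ true  ()
[1+χ≡ᵇ1]≢ false ()

χ-T : ∀ b → T b → χ b ≡ 1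
χ-T true _ = refl

-- Tuples of elements of an infinite set.

next-element : ∀ H → Infinite H → ∃[ g ] Computable H g × (∀ n → n < g n × g n ∈ₛ H)
next-element H infinite = g , g-c , λ n → correct (test≡0 n)
  where
  test : ℕ → ℕ → ℕ
  -- The test vanishes exactly when `v` exceeds `n` and lies in `H`. Searching for a zero makes `g`
  -- computable from `H`; `infinite` only supplies termination.
  test n v = ifZero (v ∸ n) 1 (ifZero (χ (H v)) 1 0)
  testᶜ : Computable H (λ p → test (fst p) (snd p))
  testᶜ = ifZeroᶜ (∸ᶜ (sndᶜ idᶜ) (fstᶜ idᶜ)) (constᶜ 1) (ifZeroᶜ (oracleᶜ (sndᶜ idᶜ)) (constᶜ 1) (constᶜ 0))
  exists : ∀ n → ∃[ v ] test n v ≡ 0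
  exists n with infinite n
  ... | v , n<v , v∈H with v ∸ n in eq₁ | m<n⇒0<n∸m n<v
  ...   | suc d | _ = v , zero-test
    where
    zero-test : test n v ≡ 0
    zero-test rewrite eq₁ | χ-T (H v) v∈H = trans (ifZero-suc d _ _) (ifZero-suc 0 _ _)
  correct : ∀ {n v} → test n v ≡ 0 → n < v × v ∈ₛ H
  correct {n} {v} t≡0 with v ∸ n in eq₁
  ... | zero = contradiction (trans (sym (ifZero-zero _ _)) t≡0) λ ()
  ... | suc d with H v
  ...   | true  = m∸n≢0⇒n<m (λ ≡0 → contradiction (trans (sym eq₁) ≡0) λ ()) , tt
  ...   | false = contradiction (trans (sym (ifZero-zero 1 0)) (trans (sym (ifZero-suc d 1 _)) t≡0)) λ ()
  search = μᶜ test testᶜ exists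
  g = proj₁ search
  g-c = proj₁ (proj₂ search)
  test≡0 = proj₂ (proj₂ search)

module Tuple {H : 2^ω} (g : ℕ → ℕ) (g-next : ∀ n → n < g n × g n ∈ₛ H) (b : ℕ) where

  -- The seed `b` sits at position `k`; before it come `k` elements of `H`, in decreasing order
  -- because each new one is put in front.
  tuple : ℕ → ℕ
  tuple k = rec ⟪ b , 0 ⟫ (λ _ u → ⟪ g (at u 0) , u ⟫) k

  tuple-zero : at (tuple 0) 0 ≡ b
  tuple-zero = trans (cong (λ u → at u 0) (rec-zero _ _)) (at-zero b 0)

  tuple-head : ∀ k → at (tuple (suc k)) 0 ≡ g (at (tuple k) 0)
  tuple-head k = trans (cong (λ u → at u 0) (rec-suc _ _ k)) (at-zero _ _)

  tuple-tail : ∀ k i → at (tuple (suc k)) (suc i) ≡ at (tuple k) i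
  tuple-tail k i = trans (cong (λ u → at u (suc i)) (rec-suc _ _ k)) (at-suc _ _ i)

  head-< : ∀ k → at (tuple k) 0 < at (tuple (suc k)) 0
  head-< k = subst (at (tuple k) 0 <_) (sym (tuple-head k)) (proj₁ (g-next _))

  b≤head : ∀ k → b ≤ at (tuple k) 0
  b≤head zero    = ≤-reflexive (sym tuple-zero)
  b≤head (suc k) = <⇒≤ (≤-<-trans (b≤head k) (head-< k))

  b<entry : ∀ k i → i < k → b < at (tuple k) i
  b<entry (suc k) zero    _         = ≤-<-trans (b≤head k) (head-< k)
  b<entry (suc k) (suc i) (s≤s i<k) = subst (b <_) (sym (tuple-tail k i)) (b<entry k i i<k)

  entry∈H : ∀ k i → i < k → at (tuple k) i ∈ₛ H
  entry∈H (suc k) zero    _         = subst (_∈ₛ H) (sym (tuple-head k)) (proj₂ (g-next _))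
  entry∈H (suc k) (suc i) (s≤s i<k) = subst (_∈ₛ H) (sym (tuple-tail k i)) (entry∈H k i i<k)

  entry≤head : ∀ k i → i < k → at (tuple k) i ≤ at (tuple k) 0
  entry≤head (suc k) zero    _         = ≤-refl
  entry≤head (suc k) (suc i) (s≤s i<k) rewrite tuple-tail k i = ≤-trans (entry≤head k i i<k) (<⇒≤ (head-< k))

  decreasing : ∀ k i j → i < j → j < k → at (tuple k) j < at (tuple k) i
  decreasing (suc k) zero    (suc j) _         (s≤s j<k) rewrite tuple-tail k j = ≤-<-trans (entry≤head k j j<k) (head-< k)
  decreasing (suc k) (suc i) (suc j) (s≤s i<j) (s≤s j<k) rewrite tuple-tail k i | tuple-tail k j = decreasing k i j i<j j<k

  tuple-distinct : ∀ k → Distinct (tuple k) k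
  tuple-distinct k i j i<j j<k same = <⇒≢ (decreasing k i j i<j j<k) (sym same)

tupleᶜ : ∀ {H : 2^ω} {g g-next b k} → Computable H g → Computable H b → Computable H k →
         Computable H (λ n → Tuple.tuple {H} g g-next (b n) (k n))
tupleᶜ g b k = recᶜ ⟪ b , constᶜ 0 ⟫ᶜ ⟪ g ∘ᶜ atᶜ (sndᶜ (sndᶜ idᶜ)) (constᶜ 0) , sndᶜ (sndᶜ idᶜ) ⟫ᶜ k

-- The coloring and the diagonally noncomputable function.

module _ {ℓ : Level} (I : Pred 2^ω ℓ) (ideal : IsTuringIdeal I) (srt : I ⊨SRT²₂) {X : 2^ω} (X∈I : I X) where

  open IsTuringIdeal ideal
  open Machine X

  monotone-lpo : ∀ (a : ℕ → Bool) → Computable X (λ n → χ (a n)) → (∀ {m n} → m ≤ n → T (a m) → T (a n)) →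
                 (∃[ n ] T (a n)) ⊎ (∀ n → ¬ T (a n))
  monotone-lpo a a-c mono = decide
    (srt (λ x _ _ → a x) (≤T-closed X∈I (≤T-computable (colorSet-computable (λ x _ → a x) (a-c ∘ᶜ fstᶜ idᶜ))))
         -- The color of a pair ignores its larger element, so stability is immediate.
         (λ x → 0 , a x , λ _ _ _ → refl))
    where
    decide : (∃[ H ] I H × Infinite H × Homogeneous (λ x _ _ → a x) H) → (∃[ n ] T (a n)) ⊎ (∀ n → ¬ T (a n))
    decide (H , _ , infinite , true , homogeneous) =
      let x , _ , x∈H   = infinite 0
          y , x<y , y∈H = infinite x
      in inj₁ (x , subst T (sym (homogeneous x y x∈H y∈H x<y)) tt)
    -- Some `x` in `H` lies above any given `n`; if `a n` were true, so would be `a x`, the color of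
    -- a pair from `H`.
    decide (H , _ , infinite , false , homogeneous) = inj₂ λ n an →
      let x , n<x , x∈H = infinite n
          y , x<y , y∈H = infinite x
      in subst T (homogeneous x y x∈H y∈H x<y) (mono (<⇒≤ n<x) an)

  value-stabilises : ∀ e → ∃[ s ] ∀ z → s ≤ z → value z e ≡ value s e
  value-stabilises e = decide
    (monotone-lpo (λ s → halted s e ≡ᵇ 1) (χ-≡ᵇᶜ (haltedᶜ idᶜ (constᶜ e)) (constᶜ 1))
      (λ {m} {n} m≤n hm → ≡⇒≡ᵇ (halted n e) 1 (halted-mono e m≤n (≡ᵇ⇒≡ (halted m e) 1 hm))))
    where
    decide : (∃[ s ] T (halted s e ≡ᵇ 1)) ⊎ (∀ s → ¬ T (halted s e ≡ᵇ 1)) → ∃[ s ] ∀ z → s ≤ z → value z e ≡ value s e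
    decide (inj₁ (s , hs)) = s , λ z s≤z → halted-value e s≤z (≡ᵇ⇒≡ (halted s e) 1 hs)
    decide (inj₂ never)    = 0 , λ z _ → trans (unhalted z) (sym (unhalted 0))
      where
      unhalted : ∀ z → value z e ≡ 0
      unhalted z = unhalted-value z e λ h≡1 → never z (≡⇒≡ᵇ (halted z e) 1 h≡1)

  request : ℕ → ℕ → ℕ
  request z r = value z (fst r)

  -- Finitely many requests have a common settling stage, the maximum of the single ones.
  requests-stabilise : ∀ x → ∃[ s ] ∀ z → s ≤ z → ∀ r → r < x → request z r ≡ request s r
  requests-stabilise zero = 0 , λ _ _ _ ()
  requests-stabilise (suc x) = combine (requests-stabilise x) (value-stabilises (fst x))
    where
    combine : (∃[ s ] ∀ z → s ≤ z → ∀ r → r < x → request z r ≡ request s r) →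
              (∃[ s ] ∀ z → s ≤ z → request z x ≡ request s x) →
              ∃[ s ] ∀ z → s ≤ z → ∀ r → r < suc x → request z r ≡ request s r
    combine (s , below) (s′ , at-x) = s ⊔ s′ , λ z ≤z r r<1+x → cases z ≤z r (m≤n⇒m<n∨m≡n (≤-pred r<1+x))
      where
      cases : ∀ z → s ⊔ s′ ≤ z → ∀ r → r < x ⊎ r ≡ x → request z r ≡ request (s ⊔ s′) r
      cases z ≤z r (inj₁ r<x)  = trans (below z (m⊔n≤o⇒m≤o s s′ ≤z) r r<x) (sym (below _ (m≤m⊔n s s′) r r<x))
      cases z ≤z r (inj₂ refl) = trans (at-x z (m⊔n≤o⇒n≤o s s′ ≤z)) (sym (at-x _ (m≤n⊔m s s′)))

  -- Unclaimed numbers and marks other than `1` get `false`. The last `x` admits only requirements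
  -- below `x`.
  color : ℕ → ℕ → Bool
  color x z = mark (request z) x x ≡ᵇ 1

  color-computable : Computable X (λ n → χ (color (fst n) (snd n)))
  color-computable = χ-≡ᵇᶜ (markᶜ request (λ z r → valueᶜ z (fstᶜ r)) (sndᶜ idᶜ) (fstᶜ idᶜ) (fstᶜ idᶜ)) (constᶜ 1)

  color-stable : Stable (λ x z _ → color x z)
  color-stable x =
    let s , stable = requests-stabilise x
    in s , color x s , λ z s<z _ → cong (_≡ᵇ 1) (mark-cong x x (stable z (<⇒≤ s<z)))

  module _ {H : 2^ω} (H∈I : I H) (infinite : Infinite H) (c : Bool)
           (homogeneous : ∀ x y → x ∈ₛ H → y ∈ₛ H → x < y → color x y ≡ c)
           (g : ℕ → ℕ) (g-c : Computable H g) (g-next : ∀ n → n < g n × g n ∈ₛ H) where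

    -- Requirement r gives its claim mark suc (χ c), hence the color opposite to c.
    requirement : ℕ → ℕ
    requirement e = ⟪ e , χ c ⟫

    -- Seed `r` puts the entries above `r`, so that requirement `r` may act on them; length `r + 1`
    -- exceeds the number of earlier claims.
    h : ℕ → ℕ
    h e = Tuple.tuple {H} g g-next (requirement e) (suc (requirement e))

    h-computable : Computable H h
    h-computable = tupleᶜ {H} {g} {g-next} g-c ⟪ idᶜ , constᶜ (χ c) ⟫ᶜ (sucᶜ ⟪ idᶜ , constᶜ (χ c) ⟫ᶜ)

    h-noncomputable : DiagonallyNoncomputable X h
    h-noncomputable e converges with Φ-value e converges
    -- The larger element `z` is taken from `H` past the settling stage and above the head of `h e`,
    -- its greatest entry, so that the claimed entry is below `z`.
    ... | s , settled with infinite (s ⊔ at (h e) 0)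
    ...   | z , <z , z∈H = refute (claim-fresh (request z) r
              (subst (λ v → Distinct v (suc r)) (sym requested) (tuple-distinct (suc r))))
      where
      r = requirement e
      open Tuple {H} g g-next r
      requested : request z r ≡ h e
      requested = trans (cong (value z) (fst-⟪⟫ e (χ c))) (settled z (≤-trans (m≤m⊔n s _) (<⇒≤ <z)))
      refute : ¬ (∃[ i ] i ≤ r × claim (request z) r ≡ at (request z r) i ×
                  (∀ r′ → r′ < r → claim (request z) r′ ≢ claim (request z) r))
      refute (i , i≤r , claimed , fresh) = [1+χ≡ᵇ1]≢ c (trans (sym marked) (homogeneous x z x∈H z∈H x<z))
        where
        x = claim (request z) r
        x≡ : x ≡ at (h e) i
        x≡ = trans claimed (cong (λ v → at v i) requested)
        x∈H : x ∈ₛ H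
        x∈H = subst (_∈ₛ H) (sym x≡) (entry∈H (suc r) i (s≤s i≤r))
        r<x : r < x
        r<x = subst (r <_) (sym x≡) (b<entry (suc r) i (s≤s i≤r))
        x<z : x < z
        x<z = ≤-<-trans (subst (_≤ at (h e) 0) (sym x≡) (entry≤head (suc r) i (s≤s i≤r))) (≤-<-trans (m≤n⊔m s _) <z)
        marked : color x z ≡ (suc (χ c) ≡ᵇ 1)
        marked = cong (_≡ᵇ 1) (trans (mark-claim (request z) r x fresh r<x) (cong suc (snd-⟪⟫ e (χ c))))

    homogeneous⇒dnr : ∃[ h ] I (graph h) × DiagonallyNoncomputable X h
    homogeneous⇒dnr = h , ≤T-closed H∈I (≤T-computable (graph-computable h-computable)) , h-noncomputable

  dnr : ∃[ h ] I (graph h) × DiagonallyNoncomputable X h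
  dnr = diagonalise
    (srt (λ x z _ → color x z) (≤T-closed X∈I (≤T-computable (colorSet-computable color color-computable))) color-stable)
    where
    diagonalise : (∃[ H ] I H × Infinite H × Homogeneous (λ x z _ → color x z) H) →
                  ∃[ h ] I (graph h) × DiagonallyNoncomputable X h
    diagonalise (H , H∈I , infinite , c , homogeneous) =
      let g , g-c , g-next = next-element H infinite
      in homogeneous⇒dnr H∈I infinite c homogeneous g g-c g-next

theorem2p3 : ∀ {ℓ : Level} (I : Pred 2^ω ℓ) → IsTuringIdeal I → I ⊨SRT²₂ → I ⊨DNR
theorem2p3 I ideal srt X X∈I = dnr I ideal srt X∈I
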